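{- Let $M$ be a strongly locally scoped term with $\mathrm{ord}(M)\geq1$. Then $$\mathcal{N}(M)\leq2_{\mathrm{ord}(M)-1}^{\,\mathrm{depth}(M)\log(\mathrm{lh}(M)+\mathrm{ord}(M)+1)}.$$
   Context: **Towers.** $2_0^x=x$ and $2_{k+1}^x=2^{(2_k^x)}$; $\log$ is base 2. **Terms.** Types are $A,B::=o\mid A\to B$. Terms are those of the simply-typed $\lambda$-calculus à la Church: $M,N::=\lambda x^A.M\mid M\,N\mid x\mid *_A$, with one constant $*_A:A$ for each type $A$. All terms are well-typed, up to $\alpha$-equivalence, and obey Barendregt's convention. $\mathrm{lv}(o)=0$, $\mathrm{lv}(A\to B)=\max(\mathrm{lv}(A)+1,\mathrm{lv}(B))$; the level of a term is that of its type; $\mathrm{ord}(M)$ is the maximal level of a subterm of $M$. **Linear head reduction.** Prime redexes are pairs $(\lambda x,N)$ defined by induction on length: $*\,M_1\dots M_n$ and $x\,M_1\dots M_n$ have none; those of $\lambda x.M'$ are those of $M'$; those of $(\lambda x.M')M_1\dots M_n$ ($n\geq1$) are $(\lambda x,M_1)$ plus those of $M'M_2\dots M_n$. Generalized redexes of $M$ are the prime redexes of all subterms of $M$. The head occurrence is the leftmost occurrence of a variable or constant. If it is an occurrence $x_0$ of $x$ and $(\lambda x,N)$ is a prime redex of $M$, then $M\to_{\mathrm{lhr}}M[N/x_0]$ (only $x_0$ is replaced). $\mathcal{N}(M)$ is the length of the lhr sequence of $M$. **Strong local scope.** $M$ is strongly locally scoped if for every generalized redex $(\lambda x,N)$ in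 $M$, $N$ is closed. **Measures.** $\mathrm{depth}(*M_1\dots M_n)=1$; $\mathrm{depth}(x\,M_1\dots M_n)=\max_i\mathrm{depth}(M_i)$ (equal to $1$ if $n=0$); $\mathrm{depth}(\lambda x.M)=\mathrm{depth}(M)$; $\mathrm{depth}((\lambda x.M)M_1\dots M_n)=\max(\mathrm{depth}(M\,M_2\dots M_n),\mathrm{depth}(M_1)+1)$. $\mathrm{lh}(*M_1\dots M_n)=0$; $\mathrm{lh}(x\,M_1\dots M_n)=1+\max_i\mathrm{lh}(M_i)$ (equal to $1$ if $n=0$); $\mathrm{lh}(\lambda x.M)=\mathrm{lh}(M)$; $\mathrm{lh}((\lambda x.M)M_1\dots M_n)=\max(\mathrm{lh}(M\,M_2\dots M_n),\mathrm{lh}(M_1))$. -}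

module Defs where

open import Data.Nat using (ℕ; zero; suc; _+_; _*_; _^_; _⊔_; _≤_; _<_; NonZero)
open import Data.Nat.Properties using (m*n≢0)
open import Data.List using (List; []; _∷_; foldr)
open import Data.List.Membership.Propositional using (_∈_)
open import Data.List.Relation.Binary.Subset.Propositional using (_⊆_)
open import Data.List.Relation.Unary.Any using (here; there)
open import Data.Product using (∃-syntax; _×_)
open import Function using (_∘_; id)
open import Relation.Nullary using (¬_)
open import Relation.Binary.PropositionalEquality using (_≡_; refl)

infixr 7 _⇒_
infixl 7 _·_ _·ℝ_
infixr 5 _∷_
infix  3 _⊢_
infix  2 _⊑_ _⟶_ _∈fv_
infix  4 _≤ℝ_

data Ty : Set where
  o   : Ty
  _⇒_ : Ty → Ty → Ty

lv : Ty → ℕ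
lv o       = 0
lv (A ⇒ B) = suc (lv A) ⊔ lv B

Ctx : Set
Ctx = List Ty

-- Intrinsically typed de Bruijn terms, so that terms are taken up to α.
data _⊢_ (Γ : Ctx) : Ty → Set where
  var : ∀ {A} → A ∈ Γ → Γ ⊢ A
  ⋆   : ∀ {A} → Γ ⊢ A
  lam : ∀ {A B} → A ∷ Γ ⊢ B → Γ ⊢ A ⇒ B
  _·_ : ∀ {A B} → Γ ⊢ A ⇒ B → Γ ⊢ A → Γ ⊢ B

ord : ∀ {Γ A} → Γ ⊢ A → ℕ
ord {A = A} (var x) = lv A
ord {A = A} ⋆       = lv A
ord {A = A} (lam M) = lv A ⊔ ord M
ord {A = A} (M · N) = lv A ⊔ (ord M ⊔ ord N)

ext : ∀ {Γ Δ : Ctx} {A} → Γ ⊆ Δ → A ∷ Γ ⊆ A ∷ Δ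
ext ρ (here e)  = here e
ext ρ (there x) = there (ρ x)

rename : ∀ {Γ Δ A} → Γ ⊆ Δ → Γ ⊢ A → Δ ⊢ A
rename ρ (var x) = var (ρ x)
rename ρ ⋆       = ⋆
rename ρ (lam M) = lam (rename (ext ρ) M)
rename ρ (M · N) = rename ρ M · rename ρ N

weaken : ∀ {Γ A B} → Γ ⊢ A → B ∷ Γ ⊢ A
weaken = rename there

data _∈fv_ {Γ : Ctx} {B : Ty} (x : B ∈ Γ) : ∀ {A} → Γ ⊢ A → Set where
  var  : x ∈fv var x
  lam  : ∀ {A C} {M : A ∷ Γ ⊢ C} → there x ∈fv M → x ∈fv lam M
  appˡ : ∀ {A C} {M : Γ ⊢ A ⇒ C} {N} → x ∈fv M → x ∈fv M · N
  appʳ : ∀ {A C} {M : Γ ⊢ A ⇒ C} {N} → x ∈fv N → x ∈fv M · N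

Closed : ∀ {Γ A} → Γ ⊢ A → Set
Closed {Γ} M = ∀ {B} (x : B ∈ Γ) → ¬ (x ∈fv M)

data _⊑_ {Δ : Ctx} {B : Ty} (L : Δ ⊢ B) : ∀ {Γ A} → Γ ⊢ A → Set where
  self : L ⊑ L
  lam  : ∀ {Γ A C} {M : A ∷ Γ ⊢ C} → L ⊑ M → L ⊑ lam M
  appˡ : ∀ {Γ A C} {M : Γ ⊢ A ⇒ C} {N} → L ⊑ M → L ⊑ M · N
  appʳ : ∀ {Γ A C} {M : Γ ⊢ A ⇒ C} {N} → L ⊑ N → L ⊑ M · N

headCtx : ∀ {Γ A} → Γ ⊢ A → Ctx
headCtx {Γ} (var x) = Γ
headCtx {Γ} ⋆       = Γ
headCtx (lam M)     = headCtx M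
headCtx (M · N)     = headCtx M

headTy : ∀ {Γ A} → Γ ⊢ A → Ty
headTy {A = A} (var x) = A
headTy {A = A} ⋆       = A
headTy (lam M)         = headTy M
headTy (M · N)         = headTy M

head : ∀ {Γ A} (M : Γ ⊢ A) → headCtx M ⊢ headTy M
head (var x) = var x
head ⋆       = ⋆
head (lam M) = head M
head (M · N) = head M

toHead : ∀ {Γ A} (M : Γ ⊢ A) → Γ ⊆ headCtx M
toHead (var x) = id
toHead ⋆       = id
toHead (lam M) = toHead M ∘ there
toHead (M · N) = toHead M

replaceHead : ∀ {Γ A} (M : Γ ⊢ A) → headCtx M ⊢ headTy M → Γ ⊢ A
replaceHead (var x) P = P
replaceHead ⋆       P = P
replaceHead (lam M) P = lam (replaceHead M P)
replaceHead (M · N) P = replaceHead M P · N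

-- Args Γ A C: argument sequences taking a head of type A to a term of type C.
data Args (Γ : Ctx) : Ty → Ty → Set where
  []  : ∀ {A} → Args Γ A A
  _∷_ : ∀ {A B C} → Γ ⊢ A → Args Γ B C → Args Γ (A ⇒ B) C

weakenArgs : ∀ {Γ A B C} → Args Γ A C → Args (B ∷ Γ) A C
weakenArgs []       = []
weakenArgs (N ∷ Ns) = weaken N ∷ weakenArgs Ns

-- PrimeIn M Ns x N: (λx , N) is a prime redex of M Ns₁ … Nsₙ.  The binder of a
-- prime redex and its argument always scope over the head occurrence, so λx is
-- given as the variable it binds there and N is weakened to that context (this
-- weakening is silent under Barendregt's convention).
data PrimeIn : ∀ {Γ A C} (M : Γ ⊢ A) → Args Γ A C →
               ∀ {B} → B ∈ headCtx M → headCtx M ⊢ B → Set where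
  here  : ∀ {Γ A B C} {M : A ∷ Γ ⊢ B} {N : Γ ⊢ A} {Ns : Args Γ B C} →
          PrimeIn (lam M) (N ∷ Ns)
                  (toHead M (here refl)) (rename (toHead M) (weaken N))
  there : ∀ {Γ A B C D} {M : A ∷ Γ ⊢ B} {N : Γ ⊢ A} {Ns : Args Γ B C}
          {x : D ∈ headCtx M} {P} →
          PrimeIn M (weakenArgs Ns) x P → PrimeIn (lam M) (N ∷ Ns) x P
  lam   : ∀ {Γ A B D} {M : A ∷ Γ ⊢ B} {x : D ∈ headCtx M} {P} →
          PrimeIn M [] x P → PrimeIn (lam M) [] x P
  app   : ∀ {Γ A B C D} {M : Γ ⊢ A ⇒ B} {N : Γ ⊢ A} {Ns : Args Γ B C}
          {x : D ∈ headCtx M} {P} →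
          PrimeIn M (N ∷ Ns) x P → PrimeIn (M · N) Ns x P

PrimeRedex : ∀ {Γ A} (M : Γ ⊢ A) {B} → B ∈ headCtx M → headCtx M ⊢ B → Set
PrimeRedex M = PrimeIn M []

StronglyLocallyScoped : ∀ {Γ A} → Γ ⊢ A → Set
StronglyLocallyScoped M =
  ∀ {Δ B} {L : Δ ⊢ B} → L ⊑ M →
  ∀ {C} {x : C ∈ headCtx L} {N : headCtx L ⊢ C} → PrimeRedex L x N → Closed N

data _⟶_ {Γ A} (M : Γ ⊢ A) : Γ ⊢ A → Set where
  lhr : ∀ {x N} → head M ≡ var x → PrimeRedex M x N → M ⟶ replaceHead M N

-- 𝒩 M n: the (unique, as ⟶ is deterministic) lhr sequence of M ends in a
-- normal form after exactly n steps.
data 𝒩 {Γ A} (M : Γ ⊢ A) : ℕ → Set where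
  stop : (∀ {M′} → ¬ (M ⟶ M′)) → 𝒩 M 0
  step : ∀ {M′ n} → M ⟶ M′ → 𝒩 M′ n → 𝒩 M (suc n)

-- depthOf M (d₁ ∷ … ∷ dₙ ∷ []) is the depth of M M₁ … Mₙ when depth Mᵢ = dᵢ.
-- In the variable case, 1 is a neutral base since depths are never 0.
depthOf : ∀ {Γ A} → Γ ⊢ A → List ℕ → ℕ
depthOf (var x) ds       = foldr _⊔_ 1 ds
depthOf ⋆       ds       = 1
depthOf (lam M) []       = depthOf M []
depthOf (lam M) (d ∷ ds) = depthOf M ds ⊔ suc d
depthOf (M · N) ds       = depthOf M (depthOf N [] ∷ ds)

depth : ∀ {Γ A} → Γ ⊢ A → ℕ
depth M = depthOf M []

-- As depthOf, for lh.
lhOf : ∀ {Γ A} → Γ ⊢ A → List ℕ → ℕ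
lhOf (var x) hs       = suc (foldr _⊔_ 0 hs)
lhOf ⋆       hs       = 0
lhOf (lam M) []       = lhOf M []
lhOf (lam M) (h ∷ hs) = lhOf M hs ⊔ h
lhOf (M · N) hs       = lhOf M (lhOf N [] ∷ hs)

lh : ∀ {Γ A} → Γ ⊢ A → ℕ
lh M = lhOf M []

-- A nonnegative real x, given by its open upper cut: x a b means x < a / b.
ℝ₊ : Set₁
ℝ₊ = (a b : ℕ) .{{_ : NonZero b}} → Set

-- Intended for m ≥ 1:  log₂ m < a / b  iff  mᵇ < 2ᵃ.
log : ℕ → ℝ₊
log m a b = m ^ b < 2 ^ a

_·ℝ_ : ℕ → ℝ₊ → ℝ₊
(zero  ·ℝ x) a b = 0 < a
(suc d ·ℝ x) a b = x a (suc d * b) {{m*n≢0 (suc d) b}}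

-- 2ˣ < a / b  iff  2^(p/q) ≤ a / b for some rational p / q > x.
exp₂ : ℝ₊ → ℝ₊
exp₂ x a b = ∃[ p ] ∃[ q ] (x p (suc q) × 2 ^ p * b ^ suc q ≤ a ^ suc q)

tower : ℕ → ℝ₊ → ℝ₊
tower zero    x = x
tower (suc k) x = exp₂ (tower k x)

-- n ≤ x  iff  n is below every rational strictly above x.
_≤ℝ_ : ℕ → ℝ₊ → Set
n ≤ℝ x = ∀ a b .{{_ : NonZero b}} → x a b → n * b < a

{-# OPTIONS --safe #-}
module Submission where

-- Linear head reduction is a machine that looks variables up in a heap of prime
-- redexes, so 𝒩 is bounded by a denotational semantics in which every variable
-- costs one tick.  As the arguments of prime redexes are closed, a term of order
-- q + 1 is a tree in which variables of level at most q call closed trees of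
-- smaller depth.  If the measure of a redex is the sum of those of its parts, then
-- unfolding the calls multiplies the measure by lh + 1 at each depth, removing the
-- redexes of one level exponentiates it, and once all redexes have level at most 1
-- it bounds the number of ticks.  Removing the levels q, …, 2 from a measure of at
-- most (lh + 1)^depth gives the tower.  In order 1 every call has level 0 and just
-- moves to a smaller depth.

open import Defs
open import Data.Nat using (ℕ; zero; suc; _+_; _*_; _^_; _∸_; _⊔_; _≤_; _<_; _≥_; z≤n; s≤s; NonZero)
open import Data.Nat.Properties
open import Data.Nat.Tactic.RingSolver using (solve-∀)
open import Data.Empty using (⊥; ⊥-elim)
open import Data.List using (List; []; _∷_; foldr)
open import Data.List.Membership.Propositional using (_∈_)
open import Data.List.Relation.Binary.Subset.Propositional using (_⊆_)
open import Data.List.Relation.Unary.Any using (here; there)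
open import Data.Maybe using (Maybe; just; nothing; map)
open import Data.Product using (Σ; ∃-syntax; _×_; _,_; proj₁; proj₂)
open import Data.Sum using (_⊎_; inj₁; inj₂)
open import Data.Unit using (⊤; tt)
open import Function using (_∘_; id)
open import Relation.Binary.PropositionalEquality
  using (_≡_; refl; sym; trans; cong; cong₂; subst; subst₂)

-- Renaming

rename-cong : ∀ {Γ Δ A} {θ θ′ : Γ ⊆ Δ} → (∀ {B} (x : B ∈ Γ) → θ x ≡ θ′ x) →
              (M : Γ ⊢ A) → rename θ M ≡ rename θ′ M
rename-cong e (var x) = cong var (e x)
rename-cong e ⋆       = refl
rename-cong e (lam M) =
  cong lam (rename-cong (λ { (here p) → refl ; (there x) → cong there (e x) }) M)
rename-cong e (M · N) = cong₂ _·_ (rename-cong e M) (rename-cong e N)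

rename-∘ : ∀ {Γ Δ Θ A} (θ′ : Δ ⊆ Θ) (θ : Γ ⊆ Δ) (M : Γ ⊢ A) →
           rename θ′ (rename θ M) ≡ rename (θ′ ∘ θ) M
rename-∘ θ′ θ (var x) = refl
rename-∘ θ′ θ ⋆       = refl
rename-∘ θ′ θ (lam M) = cong lam (trans (rename-∘ (ext θ′) (ext θ) M)
  (rename-cong (λ { (here p) → refl ; (there x) → refl }) M))
rename-∘ θ′ θ (M · N) = cong₂ _·_ (rename-∘ θ′ θ M) (rename-∘ θ′ θ N)

rename-id : ∀ {Γ A} (M : Γ ⊢ A) → rename id M ≡ M
rename-id (var x) = refl
rename-id ⋆       = refl
rename-id (lam M) = cong lam (trans
  (rename-cong (λ { (here p) → refl ; (there x) → refl }) M) (rename-id M))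
rename-id (M · N) = cong₂ _·_ (rename-id M) (rename-id N)

∈fv-rename : ∀ {Γ Δ A B} (θ : Γ ⊆ Δ) {x : B ∈ Γ} {M : Γ ⊢ A} → x ∈fv M → θ x ∈fv rename θ M
∈fv-rename θ var      = var
∈fv-rename θ (lam i)  = lam (∈fv-rename (ext θ) i)
∈fv-rename θ (appˡ i) = appˡ (∈fv-rename θ i)
∈fv-rename θ (appʳ i) = appʳ (∈fv-rename θ i)

closed-rename⁻ : ∀ {Γ Δ A} (θ : Γ ⊆ Δ) {M : Γ ⊢ A} → Closed (rename θ M) → Closed M
closed-rename⁻ θ c x i = c (θ x) (∈fv-rename θ i)

-- Linear head reduction as a heap machine

-- Entries live in the whole context, not only in the part before their variable, to be comparable
-- with the arguments in `PrimeIn`, which are weakened up to the head.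
Heap : Ctx → Set
Heap Γ = ∀ A → A ∈ Γ → Maybe (Γ ⊢ A)

push : ∀ {Γ A} → Heap Γ → Maybe (Γ ⊢ A) → Heap (A ∷ Γ)
push ρ e A (here refl) = map weaken e
push ρ e A (there x)   = map weaken (ρ A x)

-- Run ρ M Ns n: evaluating M Ns₁ … Nsₖ performs n lookups of variables in ρ.
data Run : ∀ {Γ A C} → Heap Γ → Γ ⊢ A → Args Γ A C → ℕ → Set where
  unbound : ∀ {Γ A C} {ρ : Heap Γ} {x : A ∈ Γ} {Ns : Args Γ A C} →
            ρ A x ≡ nothing → Run ρ (var x) Ns 0
  lookup  : ∀ {Γ A C} {ρ : Heap Γ} {x : A ∈ Γ} {Ns : Args Γ A C} {N n} →
            ρ A x ≡ just N → Run ρ N Ns n → Run ρ (var x) Ns (suc n)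
  star    : ∀ {Γ A C} {ρ : Heap Γ} {Ns : Args Γ A C} → Run ρ ⋆ Ns 0
  lam₀    : ∀ {Γ A B} {ρ : Heap Γ} {M : A ∷ Γ ⊢ B} {n} →
            Run (push ρ nothing) M [] n → Run ρ (lam M) [] n
  lam₁    : ∀ {Γ A B C} {ρ : Heap Γ} {M : A ∷ Γ ⊢ B} {N} {Ns : Args Γ B C} {n} →
            Run (push ρ (just N)) M (weakenArgs Ns) n → Run ρ (lam M) (N ∷ Ns) n
  app     : ∀ {Γ A B C} {ρ : Heap Γ} {M : Γ ⊢ A ⇒ B} {N} {Ns : Args Γ B C} {n} →
            Run ρ M (N ∷ Ns) n → Run ρ (M · N) Ns n

headHeap : ∀ {Γ A C} → Heap Γ → (M : Γ ⊢ A) → Args Γ A C → Heap (headCtx M)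
headHeap ρ (var x) Ns       = ρ
headHeap ρ ⋆       Ns       = ρ
headHeap ρ (lam M) []       = headHeap (push ρ nothing) M []
headHeap ρ (lam M) (N ∷ Ns) = headHeap (push ρ (just N)) M (weakenArgs Ns)
headHeap ρ (M · N) Ns       = headHeap ρ M (N ∷ Ns)

headArgs : ∀ {Γ A C} (M : Γ ⊢ A) → Args Γ A C → ∃[ C′ ] Args (headCtx M) (headTy M) C′
headArgs (var x) Ns       = _ , Ns
headArgs ⋆       Ns       = _ , Ns
headArgs (lam M) []       = headArgs M []
headArgs (lam M) (N ∷ Ns) = headArgs M (weakenArgs Ns)
headArgs (M · N) Ns       = headArgs M (N ∷ Ns)

run-head : ∀ {Γ A C} {ρ : Heap Γ} (M : Γ ⊢ A) {Ns : Args Γ A C} {n} → Run ρ M Ns n →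
           Run (headHeap ρ M Ns) (head M) (proj₂ (headArgs M Ns)) n
run-head (var x) r        = r
run-head ⋆       r        = r
run-head (lam M) (lam₀ r) = run-head M r
run-head (lam M) (lam₁ r) = run-head M r
run-head (M · N) (app r)  = run-head M r

-- A reduction step leaves the spine intact, so the machine reaches the head of the reduct in the
-- same state, now with `P` in control: exactly where a lookup leads.
run-replaceHead : ∀ {Γ A C} {ρ : Heap Γ} (M : Γ ⊢ A) (Ns : Args Γ A C) {P n} →
                  Run (headHeap ρ M Ns) P (proj₂ (headArgs M Ns)) n →
                  Run ρ (replaceHead M P) Ns n
run-replaceHead (var x) Ns       r = r
run-replaceHead ⋆       Ns       r = r
run-replaceHead (lam M) []       r = lam₀ (run-replaceHead M [] r)
run-replaceHead (lam M) (N ∷ Ns) r = lam₁ (run-replaceHead M (weakenArgs Ns) r)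
run-replaceHead (M · N) Ns       r = app (run-replaceHead M (N ∷ Ns) r)

map-rename-∘ : ∀ {Γ Δ Θ A} (θ′ : Δ ⊆ Θ) (θ : Γ ⊆ Δ) (e : Maybe (Γ ⊢ A)) →
               map (rename θ′) (map (rename θ) e) ≡ map (rename (θ′ ∘ θ)) e
map-rename-∘ θ′ θ (just N) = cong just (rename-∘ θ′ θ N)
map-rename-∘ θ′ θ nothing  = refl

map-rename-id : ∀ {Γ A} (e : Maybe (Γ ⊢ A)) → e ≡ map (rename id) e
map-rename-id (just N) = cong just (sym (rename-id N))
map-rename-id nothing  = refl

headHeap-toHead : ∀ {Γ A C} (ρ : Heap Γ) (M : Γ ⊢ A) (Ns : Args Γ A C) {B} (x : B ∈ Γ) →
                  headHeap ρ M Ns B (toHead M x) ≡ map (rename (toHead M)) (ρ B x)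
headHeap-toHead ρ (var y) Ns x = map-rename-id (ρ _ x)
headHeap-toHead ρ ⋆       Ns x = map-rename-id (ρ _ x)
headHeap-toHead ρ (lam M) [] x =
  trans (headHeap-toHead (push ρ nothing) M [] (there x)) (map-rename-∘ (toHead M) there (ρ _ x))
headHeap-toHead ρ (lam M) (N ∷ Ns) x =
  trans (headHeap-toHead (push ρ (just N)) M (weakenArgs Ns) (there x))
        (map-rename-∘ (toHead M) there (ρ _ x))
headHeap-toHead ρ (M · N) Ns x = headHeap-toHead ρ M (N ∷ Ns) x

prime⇒headHeap : ∀ {Γ A C} (ρ : Heap Γ) {M : Γ ⊢ A} {Ns : Args Γ A C} {B}
                 {x : B ∈ headCtx M} {P} → PrimeIn M Ns x P → headHeap ρ M Ns B x ≡ just P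
prime⇒headHeap ρ (here {M = M} {N} {Ns}) =
  headHeap-toHead (push ρ (just N)) M (weakenArgs Ns) (here refl)
prime⇒headHeap ρ (there p) = prime⇒headHeap (push ρ _) p
prime⇒headHeap ρ (lam p)   = prime⇒headHeap (push ρ nothing) p
prime⇒headHeap ρ (app p)   = prime⇒headHeap ρ p

Inherited : ∀ {Γ A} → Heap Γ → (M : Γ ⊢ A) → ∀ {B} → B ∈ headCtx M → headCtx M ⊢ B → Set
Inherited {Γ} ρ M {B} x P =
  Σ (B ∈ Γ) λ y → ∃[ N ] (ρ B y ≡ just N × x ≡ toHead M y × P ≡ rename (toHead M) N)

map-just⁻ : ∀ {Γ Δ A} {θ : Γ ⊆ Δ} (e : Maybe (Γ ⊢ A)) {N} → map (rename θ) e ≡ just N →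
            ∃[ N′ ] (e ≡ just N′ × N ≡ rename θ N′)
map-just⁻ (just N′) refl = N′ , refl , refl

-- On the way to the head, only an abstraction that meets an argument fills a heap cell, and this is
-- a prime redex. From the empty heap nothing can be inherited.
headHeap⇒prime : ∀ {Γ A C} (ρ : Heap Γ) (M : Γ ⊢ A) (Ns : Args Γ A C) {B}
                 (x : B ∈ headCtx M) {P} → headHeap ρ M Ns B x ≡ just P →
                 PrimeIn M Ns x P ⊎ Inherited ρ M x P
headHeap⇒prime ρ (var y) Ns x e = inj₂ (x , _ , e , refl , sym (rename-id _))
headHeap⇒prime ρ ⋆       Ns x e = inj₂ (x , _ , e , refl , sym (rename-id _))
headHeap⇒prime ρ (lam M) [] x e with headHeap⇒prime (push ρ nothing) M [] x e
... | inj₁ p = inj₁ (lam p)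
... | inj₂ (here refl , _ , () , _)
... | inj₂ (there y , N , e′ , refl , refl) with map-just⁻ (ρ _ y) e′
...   | N′ , e″ , refl = inj₂ (y , N′ , e″ , refl , rename-∘ (toHead M) there N′)
headHeap⇒prime ρ (lam M) (N ∷ Ns) x e
  with headHeap⇒prime (push ρ (just N)) M (weakenArgs Ns) x e
... | inj₁ p = inj₁ (there p)
... | inj₂ (here refl , _ , refl , refl , refl) = inj₁ here
... | inj₂ (there y , N , e′ , refl , refl) with map-just⁻ (ρ _ y) e′
...   | N′ , e″ , refl = inj₂ (y , N′ , e″ , refl , rename-∘ (toHead M) there N′)
headHeap⇒prime ρ (M · N) Ns x e with headHeap⇒prime ρ M (N ∷ Ns) x e
... | inj₁ p = inj₁ (app p)
... | inj₂ i = inj₂ i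

∅ : ∀ {Γ} → Heap Γ
∅ _ _ = nothing

head-view : ∀ {Γ A} (M : Γ ⊢ A) → (∃[ x ] head M ≡ var x) ⊎ head M ≡ ⋆
head-view (var x) = inj₁ (x , refl)
head-view ⋆       = inj₂ refl
head-view (lam M) = head-view M
head-view (M · N) = head-view M

run-head-≡ : ∀ {Γ A n} (M : Γ ⊢ A) {T} → head M ≡ T → Run ∅ M [] n →
             Run (headHeap ∅ M []) T (proj₂ (headArgs M [])) n
run-head-≡ M refl = run-head M

run⇒𝒩 : ∀ {Γ A n} (M : Γ ⊢ A) → Run ∅ M [] n → 𝒩 M n
run⇒𝒩 M r with head-view M
... | inj₂ e with run-head-≡ M e r
...   | star = stop λ { (lhr e′ _) → star≢var (trans (sym e) e′) }
  where
  star≢var : ∀ {Γ A} {x : A ∈ Γ} → ⋆ ≡ var x → ⊥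
  star≢var ()
run⇒𝒩 M r | inj₁ (x , e) with run-head-≡ M e r
... | unbound u = stop λ { (lhr e′ p) → no-redex (trans (sym e) e′) p u }
  where
  no-redex : ∀ {x y : headTy M ∈ headCtx M} {N : headCtx M ⊢ headTy M} → var x ≡ var y →
             PrimeRedex M y N → headHeap ∅ M [] _ x ≡ nothing → ⊥
  no-redex refl p u with trans (sym u) (prime⇒headHeap ∅ p)
  ... | ()
... | lookup u r′ with headHeap⇒prime ∅ M [] x u
-- The recursion is on the number of lookups; the new run is not part of the old one.
...   | inj₁ p = step (lhr e p) (run⇒𝒩 (replaceHead M _) (run-replaceHead M [] r′))
...   | inj₂ (_ , _ , () , _)

-- Cost semantics

⟦_⟧ : Ty → Set
⟦ o ⟧     = ℕ
⟦ A ⇒ B ⟧ = ⟦ A ⟧ → ⟦ B ⟧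

zeroᵛ : ∀ A → ⟦ A ⟧
zeroᵛ o       = 0
zeroᵛ (A ⇒ B) = λ _ → zeroᵛ B

tick : ∀ A → ⟦ A ⟧ → ⟦ A ⟧
tick o       n = suc n
tick (A ⇒ B) f = tick B ∘ f

total : ∀ A → ⟦ A ⟧ → ℕ
total o       n = n
total (A ⇒ B) f = total B (f (zeroᵛ A))

total-tick : ∀ A v → total A (tick A v) ≡ suc (total A v)
total-tick o       v = refl
total-tick (A ⇒ B) v = total-tick B (v (zeroᵛ A))

Env : Ctx → Set
Env []      = ⊤
Env (A ∷ Γ) = Env Γ × ⟦ A ⟧

get : ∀ {Γ A} → A ∈ Γ → Env Γ → ⟦ A ⟧
get (here refl) γ = proj₂ γ
get (there x)   γ = get x (proj₁ γ)

zeroEnv : ∀ Γ → Env Γ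
zeroEnv []      = tt
zeroEnv (A ∷ Γ) = zeroEnv Γ , zeroᵛ A

-- Every occurrence of a variable is charged one lookup, even an unbound one:
-- this overestimates a run by at most one.
⟦_⟧ᵗ : ∀ {Γ A} → Γ ⊢ A → Env Γ → ⟦ A ⟧
⟦ var {A} x ⟧ᵗ γ = tick A (get x γ)
⟦ ⋆ {A} ⟧ᵗ     γ = zeroᵛ A
⟦ lam M ⟧ᵗ     γ = λ a → ⟦ M ⟧ᵗ (γ , a)
⟦ M · N ⟧ᵗ     γ = ⟦ M ⟧ᵗ γ (⟦ N ⟧ᵗ γ)

Extends : ∀ {Γ Δ} → Γ ⊆ Δ → Heap Γ → Heap Δ → Set
Extends {Γ} θ ρ ρ′ = ∀ A (x : A ∈ Γ) → ρ′ A (θ x) ≡ map (rename θ) (ρ A x)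

RunsIn : ∀ {Γ A C} → Heap Γ → Γ ⊢ A → Args Γ A C → ℕ → Set
RunsIn ρ M Ns n = ∃[ m ] (m ≤ n × Run ρ M Ns m)

mutual
  -- A logical relation by orthogonality, Kripke-style over heap extensions: a term is tested
  -- against argument sequences, and applying `v` to their values yields the budget. Missing
  -- arguments count as `zeroᵛ`, through `total`.
  Realizes : ∀ A {Γ} → Heap Γ → Γ ⊢ A → ⟦ A ⟧ → Set
  Realizes A {Γ} ρ M v =
    ∀ {Δ} (θ : Γ ⊆ Δ) (ρ′ : Heap Δ) → Extends θ ρ ρ′ →
    ∀ {C} (Ns : Args Δ A C) n → RealizesArgs A ρ′ Ns v n → RunsIn ρ′ (rename θ M) Ns n

  RealizesArgs : ∀ A {Γ C} → Heap Γ → Args Γ A C → ⟦ A ⟧ → ℕ → Set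
  RealizesArgs A       ρ []       v n = total A v ≤ n
  RealizesArgs (A ⇒ B) ρ (N ∷ Ns) f n = ∃[ a ] (Realizes A ρ N a × RealizesArgs B ρ Ns (f a) n)

realizes-mono : ∀ {A Γ Δ} {ρ : Heap Γ} {ρ′ : Heap Δ} (θ : Γ ⊆ Δ) → Extends θ ρ ρ′ →
                ∀ {M v} → Realizes A ρ M v → Realizes A ρ′ (rename θ M) v
realizes-mono {ρ = ρ} θ e {M} r θ′ ρ″ e′ Ns n s =
  subst (λ T → RunsIn ρ″ T Ns n) (sym (rename-∘ θ′ θ M))
    (r (θ′ ∘ θ) ρ″
       (λ A x → trans (e′ A (θ x)) (trans (cong (map (rename θ′)) (e A x)) (map-rename-∘ θ′ θ (ρ A x))))
       Ns n s)

realizesArgs-weaken : ∀ {A Γ C B} {ρ : Heap Γ} (e : Maybe (Γ ⊢ B)) (Ns : Args Γ A C) {v n} →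
                      RealizesArgs A ρ Ns v n →
                      RealizesArgs A (push ρ e) (weakenArgs Ns) v n
realizesArgs-weaken e []       t           = t
realizesArgs-weaken {ρ = ρ} e (N ∷ Ns) (a , r , s) =
  a , realizes-mono {ρ = ρ} {push ρ e} there (λ _ _ → refl) {N} r , realizesArgs-weaken e Ns s

-- A tick on a function is passed on to its result, so it survives all arguments and pays for the
-- lookup.
realizesArgs-tick : ∀ {A Γ C} {ρ : Heap Γ} (Ns : Args Γ A C) {v n} →
                    RealizesArgs A ρ Ns (tick A v) n →
                    ∃[ n′ ] (n ≡ suc n′ × RealizesArgs A ρ Ns v n′)
realizesArgs-tick {A} [] {v} t with subst (_≤ _) (total-tick A v) t
... | s≤s t′ = _ , refl , t′
realizesArgs-tick (N ∷ Ns) (a , r , s) with realizesArgs-tick Ns s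
... | n′ , e , s′ = n′ , e , a , r , s′

HeapRealizes : ∀ {Γ Δ} → Γ ⊆ Δ → Heap Δ → Env Γ → Set
HeapRealizes {Γ} θ ρ γ =
  ∀ {B} (x : B ∈ Γ) {N} → ρ B (θ x) ≡ just N → Realizes B ρ N (get x γ)

heapRealizes-mono : ∀ {Γ Δ Θ} {θ : Γ ⊆ Δ} {ρ : Heap Δ} {ρ′ : Heap Θ} (θ′ : Δ ⊆ Θ) →
                    Extends θ′ ρ ρ′ → ∀ {γ} → HeapRealizes θ ρ γ →
                    HeapRealizes (θ′ ∘ θ) ρ′ γ
heapRealizes-mono {θ = θ} {ρ} {ρ′} θ′ e {γ} h {B} x eq
  with map-just⁻ (ρ B (θ x)) (trans (sym (e B (θ x))) eq)
... | N′ , eq′ , refl = realizes-mono {ρ = ρ} {ρ′} θ′ e {N′} (h x eq′)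

heapRealizes-push : ∀ {Γ Δ A} {θ : Γ ⊆ Δ} {ρ : Heap Δ} {γ : Env Γ} (e : Maybe (Δ ⊢ A)) {a} →
                    (∀ {N} → e ≡ just N → Realizes A ρ N a) → HeapRealizes θ ρ γ →
                    HeapRealizes (ext θ) (push ρ e) (γ , a)
heapRealizes-push {ρ = ρ} e r h (here refl) eq with map-just⁻ e eq
... | N′ , eq′ , refl = realizes-mono {ρ = ρ} {push ρ e} there (λ _ _ → refl) {N′} (r eq′)
heapRealizes-push {θ = θ} {ρ} {γ} e r h (there x) eq =
  heapRealizes-mono {θ = θ} {ρ} {push ρ e} there (λ _ _ → refl) {γ} h x eq

-- The fundamental lemma. Variables without a heap entry may have any value, since the machine stops
-- at them.
realizes-⟦⟧ : ∀ {Γ Δ A C} (M : Γ ⊢ A) (θ : Γ ⊆ Δ) (ρ : Heap Δ) (γ : Env Γ) → HeapRealizes θ ρ γ →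
              (Ns : Args Δ A C) (n : ℕ) → RealizesArgs A ρ Ns (⟦ M ⟧ᵗ γ) n →
              RunsIn ρ (rename θ M) Ns n
realizes-⟦⟧ (var {A} x) θ ρ γ h Ns n s with ρ A (θ x) in eq
... | nothing = 0 , z≤n , unbound eq
... | just N with realizesArgs-tick Ns s
...   | n′ , refl , s′ with h x eq id ρ (λ A y → map-rename-id (ρ A y)) Ns n′ s′
...     | m , m≤ , r =
  suc m , s≤s m≤ , lookup eq (subst (λ T → Run ρ T Ns m) (rename-id N) r)
realizes-⟦⟧ ⋆ θ ρ γ h Ns n s = 0 , z≤n , star
realizes-⟦⟧ (lam M) θ ρ γ h [] n s
  -- The unbound variable gets the value `zeroᵛ` that `total` supplies for the missing argument.
  with realizes-⟦⟧ M (ext θ) (push ρ nothing) (γ , _)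
         (heapRealizes-push {θ = θ} {ρ} {γ} nothing (λ ()) h) [] n s
... | m , m≤ , r = m , m≤ , lam₀ r
realizes-⟦⟧ (lam M) θ ρ γ h (N ∷ Ns) n (a , rN , s)
  with realizes-⟦⟧ M (ext θ) (push ρ (just N)) (γ , a)
         (heapRealizes-push {θ = θ} {ρ} {γ} (just N) (λ { refl → rN }) h) (weakenArgs Ns) n
         (realizesArgs-weaken (just N) Ns s)
... | m , m≤ , r = m , m≤ , lam₁ r
realizes-⟦⟧ (M · N) θ ρ γ h Ns n s
  with realizes-⟦⟧ M θ ρ γ h (rename θ N ∷ Ns) n (⟦ N ⟧ᵗ γ , rN , s)
  where
  rN : Realizes _ ρ (rename θ N) (⟦ N ⟧ᵗ γ)
  rN θ′ ρ′ e Ns′ n′ s′ =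
    subst (λ T → RunsIn ρ′ T Ns′ n′) (sym (rename-∘ θ′ θ N))
      (realizes-⟦⟧ N (θ′ ∘ θ) ρ′ γ (heapRealizes-mono {θ = θ} {ρ} {ρ′} θ′ e {γ} h) Ns′ n′ s′)
... | m , m≤ , r = m , m≤ , app r

adequacy : ∀ {Γ A} (M : Γ ⊢ A) →
           ∃[ n ] (𝒩 M n × n ≤ total A (⟦ M ⟧ᵗ (zeroEnv Γ)))
adequacy {Γ} M with realizes-⟦⟧ M id ∅ (zeroEnv Γ) (λ { x () }) [] _ ≤-refl
... | n , n≤ , r = n , run⇒𝒩 M (subst (λ T → Run ∅ T [] n) (rename-id M) r) , n≤

-- Unfolding the closed arguments

-- Unfolded q H Γ A D h v: v is denoted by a tree whose redexes have been
-- replaced by calls to closed trees of height H; calls are nested D deep, and h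
-- counts the nesting of variables and calls through their arguments.
mutual
  data Unfolded (q H : ℕ) (Γ : Ctx) : ∀ A → ℕ → ℕ → (Env Γ → ⟦ A ⟧) → Set where
    relax : ∀ {A D h h′ v v′} → h ≤ h′ → (∀ γ → v γ ≡ v′ γ) →
            Unfolded q H Γ A D h v → Unfolded q H Γ A D h′ v′
    zer   : ∀ {A D h} → Unfolded q H Γ A D h (λ _ → zeroᵛ A)
    lam   : ∀ {A B D h v} → Unfolded q H (A ∷ Γ) B D h v →
            Unfolded q H Γ (A ⇒ B) D h (λ γ a → v (γ , a))
    neu   : ∀ {A C D h f} (x : A ∈ Γ) → UnfoldedArgs q H Γ A C D h f →
            Unfolded q H Γ C D (suc h) (λ γ → f γ (tick A (get x γ)))
    call  : ∀ {A C D h w f} → lv A ≤ q → Unfolded q H Γ A D H w →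
            UnfoldedArgs q H Γ A C (suc D) h f →
            Unfolded q H Γ C (suc D) (suc h) (λ γ → f γ (tick A (w γ)))

  data UnfoldedArgs (q H : ℕ) (Γ : Ctx) : ∀ A C → ℕ → ℕ → (Env Γ → ⟦ A ⟧ → ⟦ C ⟧) → Set where
    []  : ∀ {A D h} → UnfoldedArgs q H Γ A A D h (λ _ a → a)
    _∷_ : ∀ {A B C D h v f} → Unfolded q H Γ A D h v → UnfoldedArgs q H Γ B C D h f →
          UnfoldedArgs q H Γ (A ⇒ B) C D h (λ γ g → f γ (g (v γ)))

-- Depths are at least 1, so nothing is callable at depth 0. A closed callee unfolds in every
-- context, hence the arbitrary map `r`.
CallableAt : (q H D : ℕ) (Δ : Ctx) (A : Ty) → (Env Δ → ⟦ A ⟧) → Set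
CallableAt q H zero    Δ A w = ⊥
CallableAt q H (suc D) Δ A w = ∀ {Θ} (r : Env Θ → Env Δ) → Unfolded q H Θ A D H (w ∘ r)

data Binding (q H D : ℕ) (Δ : Ctx) (A : Ty) (w : Env Δ → ⟦ A ⟧) : Set where
  bound  : (y : A ∈ Δ) → (∀ δ → get y δ ≡ w δ) → Binding q H D Δ A w
  closed : lv A ≤ q → CallableAt q H D Δ A w → Binding q H D Δ A w

-- Asked of free variables only: a closed callee then needs no bindings, and its unfolding starts
-- afresh at a smaller depth.
Bindings : (q H D : ℕ) {Γ Δ : Ctx} → (Env Δ → Env Γ) → ∀ {A} → Γ ⊢ A → Set
Bindings q H D {Γ} {Δ} σ M =
  ∀ {B} (x : B ∈ Γ) → x ∈fv M → Binding q H D Δ B (λ δ → get x (σ δ))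

callableAt-∘ : ∀ {q H Δ Θ A w} D (r : Env Θ → Env Δ) →
               CallableAt q H D Δ A w → CallableAt q H D Θ A (w ∘ r)
callableAt-∘ (suc D) r c r′ = c (r ∘ r′)

binding-there : ∀ {q H D Δ A B w} → Binding q H D Δ A w →
                Binding q H D (B ∷ Δ) A (w ∘ proj₁)
binding-there (bound y e)    = bound (there y) (λ δ → e (proj₁ δ))
binding-there {D = D} (closed l c) = closed l (callableAt-∘ D proj₁ c)

-- An argument awaiting its function is unfolded in place if it ends up below a
-- variable, and as a callee if it ends up in a redex.
data Pending (q H D : ℕ) (Δ : Ctx) {Γ : Ctx} : ∀ {A C} → Args Γ A C → List ℕ → List ℕ →
             (Env Δ → ⟦ A ⟧ → ⟦ C ⟧) → Set where
  []   : ∀ {A} → Pending q H D Δ {A = A} [] [] [] (λ _ a → a)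
  cons : ∀ {A B C} {N : Γ ⊢ A} {Ns : Args Γ B C} {d h ds hs v f} →
         (d ≤ suc D → h ≤ H → Unfolded q H Δ A D h v) →
         (Closed N → d ≤ D → h ≤ H → CallableAt q H D Δ A v) →
         Pending q H D Δ Ns ds hs f →
         Pending q H D Δ (N ∷ Ns) (d ∷ ds) (h ∷ hs) (λ δ g → f δ (g (v δ)))

pending-weaken : ∀ {q H D Δ Γ A C B} {Ns : Args Γ A C} {ds hs f} → Pending q H D Δ Ns ds hs f →
                 Pending q H D Δ (weakenArgs {B = B} Ns) ds hs f
pending-weaken []           = []
pending-weaken (cons u c p) = cons u (λ cl → c (closed-rename⁻ there cl)) (pending-weaken p)

pending-zero : ∀ {q H D Δ Γ A C} {Ns : Args Γ A C} {ds hs f} → Pending q H D Δ Ns ds hs f →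
               ∀ δ → zeroᵛ C ≡ f δ (zeroᵛ A)
pending-zero []           δ = refl
pending-zero (cons u c p) δ = pending-zero p δ

pending⇒args : ∀ {q H D Δ Γ A C} {Ns : Args Γ A C} {ds hs f} → Pending q H D Δ Ns ds hs f →
               ∀ {h} → foldr _⊔_ 1 ds ≤ suc D → foldr _⊔_ 0 hs ≤ h → h ≤ H →
               UnfoldedArgs q H Δ A C D h f
pending⇒args []           d≤ h≤ h≤H = []
pending⇒args {H = H} (cons {d = d} {h} {ds} {hs} u c p) d≤ h≤ h≤H =
  relax (m⊔n≤o⇒m≤o h _ h≤) (λ _ → refl)
    (u (m⊔n≤o⇒m≤o d _ d≤) (≤-trans (m⊔n≤o⇒m≤o h _ h≤) h≤H)) ∷
  pending⇒args p (m⊔n≤o⇒n≤o d _ d≤) (m⊔n≤o⇒n≤o h _ h≤) h≤H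

1≤depthOf : ∀ {Γ A} (M : Γ ⊢ A) ds → 1 ≤ depthOf M ds
1≤depthOf (var x) []       = ≤-refl
1≤depthOf (var x) (d ∷ ds) = ≤-trans (1≤depthOf (var x) ds) (m≤n⊔m d _)
1≤depthOf ⋆       ds       = ≤-refl
1≤depthOf (lam M) []       = 1≤depthOf M []
1≤depthOf (lam M) (d ∷ ds) = ≤-trans (1≤depthOf M ds) (m≤m⊔n _ (suc d))
1≤depthOf (M · N) ds       = 1≤depthOf M _

lv≤ord : ∀ {Γ A} (M : Γ ⊢ A) → lv A ≤ ord M
lv≤ord (var x) = ≤-refl
lv≤ord ⋆       = ≤-refl
lv≤ord (lam M) = m≤m⊔n _ (ord M)
lv≤ord (M · N) = m≤m⊔n _ _

ArgsClosed : ∀ {Γ A C} → Γ ⊢ A → Args Γ A C → Set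
ArgsClosed M Ns = ∀ {B} {x : B ∈ headCtx M} {P} → PrimeIn M Ns x P → Closed P

unfold : ∀ {q H D Γ Δ A C} (M : Γ ⊢ A) (σ : Env Δ → Env Γ) {Ns : Args Γ A C} {ds hs f} →
         StronglyLocallyScoped M → ArgsClosed M Ns → ord M ≤ suc q → Bindings q H D σ M →
         Pending q H D Δ Ns ds hs f → depthOf M ds ≤ suc D → lhOf M hs ≤ H →
         Unfolded q H Δ C D (lhOf M hs) (λ δ → f δ (⟦ M ⟧ᵗ (σ δ)))
unfold {q} {H} {D} (var {A} x) σ {f = f} s c k b p d≤ h≤ =
  go D (b x var) (pending⇒args p d≤ ≤-refl (≤-trans (n≤1+n _) h≤))
  where
  go : ∀ D {h} → Binding q H D _ A (λ δ → get x (σ δ)) →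
       UnfoldedArgs q H _ A _ D h f →
       Unfolded q H _ _ D (suc h) (λ δ → f δ (tick A (get x (σ δ))))
  go D       (bound y e)  as = relax ≤-refl (λ δ → cong (λ a → f δ (tick A a)) (e δ)) (neu y as)
  go (suc D) (closed l w) as = call l (w id) as
unfold ⋆ σ s c k b p d≤ h≤ = relax z≤n (pending-zero p) zer
unfold {D = D} (lam M) σ s c k b [] d≤ h≤ =
  lam (unfold M (λ { (δ , a) → σ δ , a }) (λ i → s (lam i)) (λ r → c (lam r))
         (m⊔n≤o⇒n≤o _ (ord M) k) b′ [] d≤ h≤)
  where
  b′ : Bindings _ _ D _ M
  b′ (here refl) i = bound (here refl) (λ _ → refl)
  b′ (there x)   i = binding-there {D = D} (b x (lam i))
unfold {q} {H} {D} (lam {A} {B} M) σ s c k b (cons {d = d} {h} {ds} {hs} {v} u w p) d≤ h≤ =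
  relax (m≤m⊔n _ h) (λ _ → refl)
    (unfold M (λ δ → σ δ , v δ) (λ i → s (lam i)) (λ r → c (there r))
       (m⊔n≤o⇒n≤o _ (ord M) k) b′ (pending-weaken p)
       (m⊔n≤o⇒m≤o _ (suc d) d≤) (m⊔n≤o⇒m≤o _ h h≤))
  where
  b′ : Bindings q H D _ M
  b′ (here refl) i = closed
    -- The abstraction has level at least `suc (lv A)` and at most `suc q`.
    (≤-pred (m⊔n≤o⇒m≤o (suc (lv A)) (lv B) (m⊔n≤o⇒m≤o _ (ord M) k)))
    (w (closed-rename⁻ there (closed-rename⁻ (toHead M) (c here)))
       (≤-pred (m⊔n≤o⇒n≤o (depthOf M ds) (suc d) d≤)) (m⊔n≤o⇒n≤o (lhOf M hs) h h≤))
  b′ (there x) i = b x (lam i)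
unfold {q} {H} {D} {Γ} {Δ} (_·_ {A} {B} M N) σ s c k b p d≤ h≤ =
  unfold M σ (λ i → s (appˡ i)) (λ r → c (app r)) (m⊔n≤o⇒m≤o _ (ord N) k′)
    (λ x i → b x (appˡ i))
    (cons (λ d≤ h≤ → unfold N σ (λ i → s (appʳ i)) (s (appʳ self)) oN (λ x i → b x (appʳ i)) [] d≤ h≤)
          (λ cl d≤ h≤ → callee D cl d≤ h≤) p) d≤ h≤
  where
  k′ = m⊔n≤o⇒n≤o (lv B) (ord M ⊔ ord N) k
  oN = m⊔n≤o⇒n≤o (ord M) (ord N) k′
  callee : ∀ D → Closed N → depth N ≤ D → lh N ≤ H → CallableAt q H D Δ A (λ δ → ⟦ N ⟧ᵗ (σ δ))
  callee zero    cl d≤ h≤ = <⇒≱ (1≤depthOf N []) d≤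
  callee (suc D) cl d≤ h≤ r =
    relax h≤ (λ _ → refl)
      (unfold N (σ ∘ r) (λ i → s (appʳ i)) (s (appʳ self)) oN (λ x i → ⊥-elim (cl x i)) [] d≤ h≤)

-- Rank elimination

-- As in Beckmann's head trees, but a redex measures the sum of its parts: then
-- substitution multiplies measures, and redexes of level at most 1 take a number
-- of steps bounded by the measure.
mutual
  data Bounded (ρ : ℕ) (Γ : Ctx) : ∀ A → ℕ → (Env Γ → ⟦ A ⟧) → Set where
    relax : ∀ {A m m′ v v′} → m ≤ m′ → (∀ γ → v γ ≡ v′ γ) →
            Bounded ρ Γ A m v → Bounded ρ Γ A m′ v′
    zer   : ∀ {A m} → Bounded ρ Γ A m (λ _ → zeroᵛ A)
    lam   : ∀ {A B m v} → Bounded ρ (A ∷ Γ) B m v →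
            Bounded ρ Γ (A ⇒ B) m (λ γ a → v (γ , a))
    step  : ∀ {A m v} → Bounded ρ Γ A m v → Bounded ρ Γ A (suc m) (λ γ → tick A (v γ))
    neu   : ∀ {A C m f} (x : A ∈ Γ) → BoundedArgs ρ Γ A C m f →
            Bounded ρ Γ C (suc m) (λ γ → f γ (tick A (get x γ)))
    cut   : ∀ {A C m k w f} → lv A ≤ ρ → Bounded ρ Γ A m w → BoundedArgs ρ Γ A C k f →
            Bounded ρ Γ C (m + k) (λ γ → f γ (w γ))

  data BoundedArgs (ρ : ℕ) (Γ : Ctx) : ∀ A C → ℕ → (Env Γ → ⟦ A ⟧ → ⟦ C ⟧) → Set where
    []  : ∀ {A m} → BoundedArgs ρ Γ A A m (λ _ a → a)
    _∷_ : ∀ {A B C m v f} → Bounded ρ Γ A m v → BoundedArgs ρ Γ B C m f →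
          BoundedArgs ρ Γ (A ⇒ B) C m (λ γ g → f γ (g (v γ)))

relaxArgs : ∀ {ρ Γ A C m m′ f} → m ≤ m′ → BoundedArgs ρ Γ A C m f → BoundedArgs ρ Γ A C m′ f
relaxArgs le []       = []
relaxArgs le (t ∷ ts) = relax le (λ _ → refl) t ∷ relaxArgs le ts

_++ᵃ_ : ∀ {ρ Γ A B C m f g} → BoundedArgs ρ Γ A B m f → BoundedArgs ρ Γ B C m g →
        BoundedArgs ρ Γ A C m (λ γ a → g γ (f γ a))
[]       ++ᵃ us = us
(t ∷ ts) ++ᵃ us = t ∷ (ts ++ᵃ us)

-- Renamings and substitutions are given by maps of environments, so that they act on denotations by
-- composition.
IsRenaming : ∀ {Γ Δ} → (Env Δ → Env Γ) → Set
IsRenaming {Γ} {Δ} r = ∀ {B} (x : B ∈ Γ) → Σ (B ∈ Δ) λ y → ∀ δ → get y δ ≡ get x (r δ)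

lift-renaming : ∀ {Γ Δ A} {r : Env Δ → Env Γ} → IsRenaming r →
                IsRenaming {A ∷ Γ} {A ∷ Δ} (λ δ → r (proj₁ δ) , proj₂ δ)
lift-renaming i (here refl) = here refl , λ _ → refl
lift-renaming i (there x)   = there (proj₁ (i x)) , λ δ → proj₂ (i x) (proj₁ δ)

mutual
  bounded-rename : ∀ {ρ Γ Δ A m v} {r : Env Δ → Env Γ} → IsRenaming r →
                   Bounded ρ Γ A m v → Bounded ρ Δ A m (v ∘ r)
  bounded-rename i (relax le e t) = relax le (λ δ → e _) (bounded-rename i t)
  bounded-rename i zer            = zer
  bounded-rename i (lam t)        = lam (bounded-rename (lift-renaming i) t)
  bounded-rename i (step t)       = step (bounded-rename i t)
  bounded-rename {r = r} i (neu {A} {f = f} x ts) =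
    relax ≤-refl (λ δ → cong (λ a → f (r δ) (tick A a)) (proj₂ (i x) δ))
      (neu (proj₁ (i x)) (boundedArgs-rename i ts))
  bounded-rename i (cut l t ts)   = cut l (bounded-rename i t) (boundedArgs-rename i ts)

  boundedArgs-rename : ∀ {ρ Γ Δ A C m f} {r : Env Δ → Env Γ} → IsRenaming r →
                       BoundedArgs ρ Γ A C m f → BoundedArgs ρ Δ A C m (f ∘ r)
  boundedArgs-rename i []       = []
  boundedArgs-rename i (t ∷ ts) = bounded-rename i t ∷ boundedArgs-rename i ts

data Image (ρ k : ℕ) (Δ : Ctx) (A : Ty) (w : Env Δ → ⟦ A ⟧) : Set where
  bound : (y : A ∈ Δ) → (∀ δ → get y δ ≡ w δ) → Image ρ k Δ A w
  tree  : lv A ≤ ρ → Bounded ρ Δ A k w → Image ρ k Δ A w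

IsSubst : (ρ k : ℕ) {Γ Δ : Ctx} → (Env Δ → Env Γ) → Set
IsSubst ρ k {Γ} {Δ} σ = ∀ {B} (x : B ∈ Γ) → Image ρ k Δ B (λ δ → get x (σ δ))

lift-subst : ∀ {ρ k Γ Δ A} {σ : Env Δ → Env Γ} → IsSubst ρ k σ →
             IsSubst ρ k {A ∷ Γ} {A ∷ Δ} (λ δ → σ (proj₁ δ) , proj₂ δ)
lift-subst s (here refl) = bound (here refl) (λ _ → refl)
lift-subst s (there x) with s x
... | bound y e = bound (there y) (λ δ → e (proj₁ δ))
... | tree l t  = tree l (bounded-rename (λ y → there y , λ _ → refl) t)

extend-subst : ∀ {ρ k Γ Δ A v} {σ : Env Δ → Env Γ} → IsSubst ρ k σ → lv A ≤ ρ →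
               Bounded ρ Δ A k v → IsSubst ρ k {A ∷ Γ} (λ δ → σ δ , v δ)
extend-subst s l t (here refl) = tree l t
extend-subst s l t (there x)   = s x

ArgLevels : ∀ ρ {Γ A C m f} → BoundedArgs ρ Γ A C m f → Set
ArgLevels ρ []             = ⊤
ArgLevels ρ (_∷_ {A} t ts) = lv A ≤ ρ × ArgLevels ρ ts

argLevels : ∀ {ρ Γ A C m f} → lv A ≤ suc ρ → (ts : BoundedArgs ρ Γ A C m f) → ArgLevels ρ ts
argLevels l []                 = tt
argLevels l (_∷_ {A} {B} t ts) =
  ≤-pred (m⊔n≤o⇒m≤o (suc (lv A)) (lv B) l) ,
  argLevels (m⊔n≤o⇒n≤o (suc (lv A)) (lv B) l) ts

mutual
  -- Substitution and application in one induction: abstractions consume arguments as further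
  -- substitutions, while variables and redexes append them to their own. Each unit of `a` pays for
  -- itself and for one substituted tree; `e` pays for the appended arguments.
  bounded-subst : ∀ {ρ k Γ Δ A C a e v f} {σ : Env Δ → Env Γ} → Bounded ρ Γ A a v →
                  IsSubst ρ k σ → (us : BoundedArgs ρ Δ A C e f) → ArgLevels ρ us → e ≤ k →
                  Bounded ρ Δ C (a * suc k + e) (λ δ → f δ (v (σ δ)))
  bounded-subst {k = k} {e = e} {f = f} (relax le eq t) s us l e≤k =
    relax (+-monoˡ-≤ e (*-monoˡ-≤ (suc k) le)) (λ δ → cong (f δ) (eq _)) (bounded-subst t s us l e≤k)
  bounded-subst zer s us l e≤k = relax z≤n (λ δ → args-zero us δ) zer
  bounded-subst (lam t) s [] l e≤k = lam (bounded-subst t (lift-subst s) [] tt e≤k)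
  bounded-subst (lam t) s (u ∷ us) (l , ls) e≤k =
    bounded-subst t (extend-subst s l (relax e≤k (λ _ → refl) u)) us ls e≤k
  bounded-subst {k = k} {a = suc a} {e} {f = f} (step {A} t) s us l e≤k =
    relax (s≤s (+-monoˡ-≤ e (m≤n+m (a * suc k) k))) (λ δ → args-tick us δ)
      (step (bounded-subst t s us l e≤k))
  bounded-subst {k = k} {e = e} {f = f} {σ = σ} (neu {A} {m = m} {g} x ts) s us l e≤k with s x
  ... | bound y eq =
    relax (s≤s (+-monoˡ-≤ e (m≤n+m (m * suc k) k)))
      (λ δ → cong (λ a → f δ (g (σ δ) (tick A a))) (eq δ))
      (neu y (subst-++ ts s us e≤k))
  -- The unit of the occurrence becomes `suc k`: one for its tick and `k` for the tree.
  ... | tree l′ t =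
    relax (≤-reflexive (sym (+-assoc (suc k) (m * suc k) e))) (λ _ → refl)
      (cut l′ (step t) (subst-++ ts s us e≤k))
  bounded-subst {k = k} {e = e} (cut {m = p} {m} l′ t ts) s us l e≤k =
    relax (≤-reflexive (arith p m k e)) (λ _ → refl)
      (cut l′ (bounded-subst t s [] tt z≤n) (subst-++ ts s us e≤k))
    where
    arith : ∀ p m k e → p * suc k + 0 + (m * suc k + e) ≡ (p + m) * suc k + e
    arith = solve-∀

  args-zero : ∀ {ρ Δ A C e f} → BoundedArgs ρ Δ A C e f → ∀ δ → zeroᵛ C ≡ f δ (zeroᵛ A)
  args-zero []       δ = refl
  args-zero (u ∷ us) δ = args-zero us δ

  args-tick : ∀ {ρ Δ A C e f} → BoundedArgs ρ Δ A C e f → ∀ δ {a} →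
              tick C (f δ a) ≡ f δ (tick A a)
  args-tick []       δ = refl
  args-tick (u ∷ us) δ = args-tick us δ

  boundedArgs-subst : ∀ {ρ k Γ Δ A C m f} {σ : Env Δ → Env Γ} → BoundedArgs ρ Γ A C m f →
                      IsSubst ρ k σ → BoundedArgs ρ Δ A C (m * suc k) (f ∘ σ)
  boundedArgs-subst []       s = []
  boundedArgs-subst (t ∷ ts) s =
    relax (≤-reflexive (+-identityʳ _)) (λ _ → refl) (bounded-subst t s [] tt z≤n) ∷
    boundedArgs-subst ts s

  subst-++ : ∀ {ρ k Γ Δ A B C m e f g} {σ : Env Δ → Env Γ} → BoundedArgs ρ Γ A B m f →
             IsSubst ρ k σ → BoundedArgs ρ Δ B C e g → e ≤ k →
             BoundedArgs ρ Δ A C (m * suc k + e) (λ δ a → g δ (f (σ δ) a))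
  subst-++ {e = e} ts s us e≤k =
    relaxArgs (m≤m+n _ e) (boundedArgs-subst ts s) ++ᵃ relaxArgs (m≤n+m e _) us

pow2-1 : ℕ → ℕ
pow2-1 zero    = 0
pow2-1 (suc m) = suc (pow2-1 m + pow2-1 m)

suc-pow2-1 : ∀ m → suc (pow2-1 m) ≡ 2 ^ m
suc-pow2-1 zero    = refl
suc-pow2-1 (suc m) = trans (arith (pow2-1 m)) (cong (2 *_) (suc-pow2-1 m))
  where
  arith : ∀ x → suc (suc (x + x)) ≡ 2 * suc x
  arith = solve-∀

pow2-1-mono : ∀ {m n} → m ≤ n → pow2-1 m ≤ pow2-1 n
pow2-1-mono {m} {n} le =
  ≤-pred (subst₂ _≤_ (sym (suc-pow2-1 m)) (sym (suc-pow2-1 n)) (^-monoʳ-≤ 2 le))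

-- The left side is the bound of `bounded-subst` for a redex whose head has measure `pow2-1 m` and
-- whose arguments have measure `pow2-1 k`. Adding one turns the claim into the product rule for
-- powers of 2.
pow2-1-+ : ∀ m k → pow2-1 m * suc (pow2-1 k) + pow2-1 k ≡ pow2-1 (m + k)
pow2-1-+ zero    k = refl
pow2-1-+ (suc m) k = trans (arith (pow2-1 m) (pow2-1 k))
  (cong (λ x → suc (x + x)) (pow2-1-+ m k))
  where
  arith : ∀ x y → suc (x + x) * suc y + y ≡ suc ((x * suc y + y) + (x * suc y + y))
  arith = solve-∀

mutual
  -- Every redex is contracted, after its parts are lowered. New redexes arise only where an
  -- argument replaces a variable, and the arguments of a function of level at most `suc ρ` have
  -- level at most `ρ`.
  lower : ∀ {ρ Γ A m v} → Bounded (suc ρ) Γ A m v → Bounded ρ Γ A (pow2-1 m) v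
  lower (relax le e t) = relax (pow2-1-mono le) e (lower t)
  lower zer            = zer
  lower (lam t)        = lam (lower t)
  lower (step {m = m} t)   = relax (s≤s (m≤m+n (pow2-1 m) _)) (λ _ → refl) (step (lower t))
  lower (neu {m = m} x ts) = relax (s≤s (m≤m+n (pow2-1 m) _)) (λ _ → refl) (neu x (lowerArgs ts))
  lower (cut {m = m} {k} l t ts) =
    relax (≤-reflexive (pow2-1-+ m k)) (λ _ → refl)
      (bounded-subst (lower t) (λ x → bound x (λ _ → refl)) (lowerArgs ts)
        (argLevels l (lowerArgs ts)) ≤-refl)

  lowerArgs : ∀ {ρ Γ A C m f} → BoundedArgs (suc ρ) Γ A C m f → BoundedArgs ρ Γ A C (pow2-1 m) f
  lowerArgs []       = []
  lowerArgs (t ∷ ts) = lower t ∷ lowerArgs ts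

tower₂ : ℕ → ℕ → ℕ
tower₂ zero    m = m
tower₂ (suc k) m = 2 ^ tower₂ k m

tower₂-mono : ∀ k {m n} → m ≤ n → tower₂ k m ≤ tower₂ k n
tower₂-mono zero    le = le
tower₂-mono (suc k) le = ^-monoʳ-≤ 2 (tower₂-mono k le)

tower₂-2^ : ∀ k m → tower₂ k (2 ^ m) ≡ 2 ^ tower₂ k m
tower₂-2^ zero    m = refl
tower₂-2^ (suc k) m = cong (2 ^_) (tower₂-2^ k m)

lower-to-1 : ∀ k {Γ A m v} → Bounded (suc k) Γ A m v → Bounded 1 Γ A (tower₂ k m) v
lower-to-1 zero t = t
lower-to-1 (suc k) {m = m} t =
  relax (≤-trans (tower₂-mono k (≤-trans (n≤1+n _) (≤-reflexive (suc-pow2-1 m))))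
                 (≤-reflexive (tower₂-2^ k m)))
        (λ _ → refl) (lower-to-1 k (lower t))

mutual
  -- A variable is paid for by `suc H ^ D`, which is at least 1. A call has `suc H ^ suc D`, that is
  -- `suc H ^ D` for the tick plus `H * suc H ^ D` for the callee.
  unfolded⇒bounded : ∀ {q H Γ A D h v} → Unfolded q H Γ A D h v →
                     Bounded q Γ A (h * suc H ^ D) v
  unfolded⇒bounded {H = H} {D = D} (relax le e t) =
    relax (*-monoˡ-≤ (suc H ^ D) le) e (unfolded⇒bounded t)
  unfolded⇒bounded zer     = zer
  unfolded⇒bounded (lam t) = lam (unfolded⇒bounded t)
  unfolded⇒bounded {H = H} {D = D} (neu x ts) =
    relax (+-monoˡ-≤ _ (m^n>0 (suc H) D)) (λ _ → refl) (neu x (unfolded⇒boundedArgs ts))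
  unfolded⇒bounded {H = H} (call {D = D} l t ts) =
    relax (+-monoˡ-≤ _ (+-monoˡ-≤ (H * suc H ^ D) (m^n>0 (suc H) D))) (λ _ → refl)
      (cut l (step (unfolded⇒bounded t)) (unfolded⇒boundedArgs ts))

  unfolded⇒boundedArgs : ∀ {q H Γ A C D h f} → UnfoldedArgs q H Γ A C D h f →
                         BoundedArgs q Γ A C (h * suc H ^ D) f
  unfolded⇒boundedArgs []       = []
  unfolded⇒boundedArgs (t ∷ ts) = unfolded⇒bounded t ∷ unfolded⇒boundedArgs ts

-- Counting lookups

-- Describes unbound variables, at which the machine stops without running their arguments.
-- `CostsFrom` describes terms, which may run arguments that are capped.
Capped : ℕ → ∀ A → ⟦ A ⟧ → Set
Capped k o       n = n ≤ k
Capped k (A ⇒ B) f = ∀ a → Capped k B (f a)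

CostsFrom : ℕ → ℕ → ∀ A → ⟦ A ⟧ → Set
CostsFrom k j o       n = n ≤ j
CostsFrom k j (A ⇒ B) f = ∀ a → Capped k A a → CostsFrom k j B (f a)

capped-zero : ∀ k A → Capped k A (zeroᵛ A)
capped-zero k o       = z≤n
capped-zero k (A ⇒ B) = λ _ → capped-zero k B

capped-mono : ∀ {k k′} A {a} → k ≤ k′ → Capped k A a → Capped k′ A a
capped-mono o       le c = ≤-trans c le
capped-mono (A ⇒ B) le c = λ a → capped-mono B le (c a)

capped-tick : ∀ {k} A {a} → Capped k A a → Capped (suc k) A (tick A a)
capped-tick o       c = s≤s c
capped-tick (A ⇒ B) c = λ a → capped-tick B (c a)

capped⇒costs : ∀ {k j} A {a} → Capped j A a → CostsFrom k j A a
capped⇒costs o       c = c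
capped⇒costs (A ⇒ B) c = λ a _ → capped⇒costs B (c a)

costs-mono : ∀ {k k′ j j′} A {a} → k′ ≤ k → j ≤ j′ → CostsFrom k j A a → CostsFrom k′ j′ A a
costs-mono o       lk lj c = ≤-trans c lj
costs-mono (A ⇒ B) lk lj c = λ a ca → costs-mono B lk lj (c a (capped-mono A lk ca))

costs-tick : ∀ {k j} A {a} → CostsFrom k j A a → CostsFrom k (suc j) A (tick A a)
costs-tick o       c = s≤s c
costs-tick (A ⇒ B) c = λ a ca → costs-tick B (c a ca)

costs-total : ∀ {j} A {a} → CostsFrom 0 j A a → total A a ≤ j
costs-total o       c = c
costs-total (A ⇒ B) c = costs-total B (c (zeroᵛ A) (capped-zero 0 A))

CappedEnv : ℕ → ∀ {Γ} → Env Γ → Set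
CappedEnv k {Γ} γ = ∀ {A} (x : A ∈ Γ) → Capped k A (get x γ)

capped-extend : ∀ {k Γ A} {γ : Env Γ} {a} → CappedEnv k γ → Capped k A a →
                CappedEnv k {A ∷ Γ} (γ , a)
capped-extend c ca (here refl) = ca
capped-extend c ca (there x)   = c x

capped-zeroEnv : ∀ Γ → CappedEnv 0 (zeroEnv Γ)
capped-zeroEnv (A ∷ Γ) (here refl) = capped-zero 0 A
capped-zeroEnv (A ∷ Γ) (there x)   = capped-zeroEnv Γ x

capped-args : ∀ {ρ k Γ A C m f a} → BoundedArgs ρ Γ A C m f → ∀ γ → Capped k A a →
              Capped k C (f γ a)
capped-args []       γ c = c
capped-args (t ∷ ts) γ c = capped-args ts γ (c _)

mutual
  -- A head of level at most 1 has only arguments of base type, where cost at most `n + k` already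
  -- means capped by `n + k`. Run under this larger cap, the head adds its own measure, so costs add
  -- up as measures do.
  bounded-costs : ∀ {Γ A m v} → Bounded 1 Γ A m v → ∀ k (γ : Env Γ) → CappedEnv k γ →
                  CostsFrom k (m + k) A (v γ)
  bounded-costs {A = A} (relax le e t) k γ c =
    costs-mono A ≤-refl (+-monoˡ-≤ k le)
      (subst (CostsFrom k _ A) (e γ) (bounded-costs t k γ c))
  bounded-costs (zer {A} {m}) k γ c = capped⇒costs A (capped-zero (m + k) A)
  bounded-costs (lam t) k γ c = λ a ca → bounded-costs t k (γ , a) (capped-extend c ca)
  bounded-costs (step {A} t) k γ c = costs-tick A (bounded-costs t k γ c)
  bounded-costs (neu {A} {C} {m} x ts) k γ c =
    capped⇒costs C (capped-mono C (s≤s (m≤n+m k m)) (capped-args ts γ (capped-tick A (c x))))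
  bounded-costs (cut {A} {C} {m} {n} l t ts) k γ c =
    costs-mono C (m≤n+m k n) (≤-reflexive (sym (+-assoc m n k)))
      (boundedArgs-costs ts l k γ c
        (bounded-costs t (n + k) γ (λ x → capped-mono _ (m≤n+m k n) (c x))))

  boundedArgs-costs : ∀ {Γ A C m f j a} → BoundedArgs 1 Γ A C m f → lv A ≤ 1 →
                      ∀ k (γ : Env Γ) → CappedEnv k γ →
                      CostsFrom (m + k) j A a → CostsFrom (m + k) j C (f γ a)
  boundedArgs-costs [] l k γ c r = r
  boundedArgs-costs (_∷_ {o} {B} t ts) l k γ c r =
    boundedArgs-costs ts (m⊔n≤o⇒n≤o 1 (lv B) l) k γ c (r _ (bounded-costs t k γ c))
  boundedArgs-costs (_∷_ {A ⇒ A′} {B} t ts) l k γ c r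
    with m⊔n≤o⇒m≤o (suc (lv A)) (lv A′) (≤-pred (m⊔n≤o⇒m≤o (suc (suc (lv A) ⊔ lv A′)) (lv B) l))
  ... | ()

capped-unfoldedArgs : ∀ {q H k Γ A C D h f a} → UnfoldedArgs q H Γ A C D h f → ∀ γ → Capped k A a →
                     Capped k C (f γ a)
capped-unfoldedArgs []       γ c = c
capped-unfoldedArgs (t ∷ ts) γ c = capped-unfoldedArgs ts γ (c _)

-- A callee of level 0 takes no arguments, so a call adds one tick and goes on at the next smaller
-- depth; the last unit is for a final variable. The measure of `Bounded` is exponential in `D`, too
-- coarse for a tower of height 0.
unfolded-costs : ∀ {H Γ A D h v} → Unfolded 0 H Γ A D h v → ∀ (γ : Env Γ) → CappedEnv 0 γ →
                 CostsFrom 0 (suc D) A (v γ)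
unfolded-costs {A = A} (relax le e t) γ c = subst (CostsFrom 0 _ A) (e γ) (unfolded-costs t γ c)
unfolded-costs (zer {A}) γ c = capped⇒costs A (capped-zero _ A)
unfolded-costs (lam t) γ c = λ a ca → unfolded-costs t (γ , a) (capped-extend c ca)
unfolded-costs (neu {A} {C} x ts) γ c =
  capped⇒costs C (capped-mono C (s≤s z≤n) (capped-unfoldedArgs ts γ (capped-tick A (c x))))
unfolded-costs (call {o} l t []) γ c = s≤s (unfolded-costs t γ c)
unfolded-costs (call {A ⇒ B} l t ts) γ c with m⊔n≤o⇒m≤o (suc (lv A)) (lv B) l
... | ()

-- Lower bounds on real towers

^-cancel-< : ∀ m n → 2 ^ m < 2 ^ n → m < n
^-cancel-< m n lt = ≰⇒> λ le → <⇒≱ lt (^-monoʳ-≤ 2 le)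

≤ℝ-mono : ∀ {n m} {x : ℝ₊} → n ≤ m → m ≤ℝ x → n ≤ℝ x
≤ℝ-mono le h a b p = ≤-<-trans (*-monoˡ-≤ b le) (h a b p)

≤ℝ-log : ∀ d {X} → 2 ≤ X → suc d ≤ℝ (suc d ·ℝ log X)
≤ℝ-log d 2≤X a b p = ^-cancel-< (suc d * b) a (≤-<-trans (^-monoˡ-≤ (suc d * b) 2≤X) p)

*-^ : ∀ m b n → (m * b) ^ n ≡ m ^ n * b ^ n
*-^ m b zero    = refl
*-^ m b (suc n) = trans (cong (m * b *_) (*-^ m b n)) (arith m b (m ^ n) (b ^ n))
  where
  arith : ∀ m b x y → m * b * (x * y) ≡ m * x * (b * y)
  arith = solve-∀

-- Compares roots without taking them: raising `a ≤ m * b` to the power `suc q` contradicts the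
-- hypotheses.
^-root-< : ∀ m p {a b} q .{{_ : NonZero b}} → m ^ suc q < 2 ^ p →
           2 ^ p * b ^ suc q ≤ a ^ suc q → m * b < a
^-root-< m p {a} {b} q lt le = ≰⇒> λ a≤mb → <⇒≱
  (<-≤-trans (*-monoˡ-< (b ^ suc q) {{m^n≢0 b (suc q)}} lt) le)
  (≤-trans (^-monoˡ-≤ (suc q) a≤mb) (≤-reflexive (*-^ m b (suc q))))

≤ℝ-exp₂ : ∀ {m} {x : ℝ₊} → m ≤ℝ x → 2 ^ m ≤ℝ exp₂ x
≤ℝ-exp₂ {m} h a b (p , q , xpq , le) =
  ^-root-< (2 ^ m) p q (subst (_< 2 ^ p) (sym (^-*-assoc 2 m (suc q)))
    (^-monoʳ-< 2 ≤-refl (h p (suc q) xpq))) le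

-- The innermost exponential cancels the logarithm exactly; `≤ℝ-exp₂` takes a natural number below
-- the exponent and would round it down.
≤ℝ-exp₂-log : ∀ d X → X ^ suc d ≤ℝ exp₂ (suc d ·ℝ log X)
≤ℝ-exp₂-log d X a b (p , q , xpq , le) =
  ^-root-< (X ^ suc d) p q (subst (_< 2 ^ p) (sym (^-*-assoc X (suc d) (suc q))) xpq) le

≤ℝ-tower : ∀ k {m} {x : ℝ₊} → m ≤ℝ exp₂ x → tower₂ k m ≤ℝ tower (suc k) x
≤ℝ-tower zero    h = h
≤ℝ-tower (suc k) {m} {x} h = ≤ℝ-exp₂ {tower₂ k m} {tower (suc k) x} (≤ℝ-tower k {m} {x} h)

-- The bound in order 1 and in higher orders

total-≤ℝ : ∀ {Γ A} (M : Γ ⊢ A) d p → StronglyLocallyScoped M → depth M ≡ suc d → ord M ≡ suc p →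
           total A (⟦ M ⟧ᵗ (zeroEnv Γ)) ≤ℝ tower p (suc d ·ℝ log (lh M + suc p + 1))
total-≤ℝ {Γ} {A} M d p s depth≡ ord≡ = go p (unfolded p (≤-reflexive ord≡))
  where
  unfolded : ∀ q → ord M ≤ suc q → Unfolded q (lh M) Γ A d (lh M) ⟦ M ⟧ᵗ
  unfolded q le = unfold M id s (s self) le (λ x _ → bound x (λ _ → refl)) []
                    (≤-reflexive depth≡) ≤-refl
  -- `lh M` may be 0, as for `⋆`; the two units come from the order and the added 1.
  2≤base : ∀ {p} → 2 ≤ lh M + suc p + 1
  2≤base {p} = +-monoˡ-≤ 1 (≤-trans (s≤s z≤n) (m≤n+m (suc p) (lh M)))
  go : ∀ p → Unfolded p (lh M) Γ A d (lh M) ⟦ M ⟧ᵗ →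
       total A (⟦ M ⟧ᵗ (zeroEnv Γ)) ≤ℝ tower p (suc d ·ℝ log (lh M + suc p + 1))
  go zero t = ≤ℝ-mono {x = suc d ·ℝ log (lh M + 1 + 1)}
    (costs-total A (unfolded-costs t (zeroEnv Γ) (capped-zeroEnv Γ))) (≤ℝ-log d 2≤base)
  -- The `k` lowerings from level `suc k` to 1 use the outer `k` exponentials. The innermost one
  -- gives `X ^ suc d`, which bounds the initial measure.
  go (suc k) t =
    ≤ℝ-mono {x = tower (suc k) x} cost≤ (≤ℝ-tower k {X ^ suc d} {x} (≤ℝ-exp₂-log d X))
    where
    H = lh M
    X = H + suc (suc k) + 1
    x = suc d ·ℝ log X
    H<X : suc H ≤ X
    H<X = ≤-trans (≤-reflexive (+-comm 1 H)) (+-monoˡ-≤ 1 (m≤m+n H _))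
    measure≤ : H * suc H ^ d ≤ X ^ suc d
    measure≤ = *-mono-≤ (≤-trans (n≤1+n H) H<X) (^-monoˡ-≤ d H<X)
    cost≤ : total A (⟦ M ⟧ᵗ (zeroEnv Γ)) ≤ tower₂ k (X ^ suc d)
    cost≤ = ≤-trans
      (costs-total A (bounded-costs (lower-to-1 k (unfolded⇒bounded t)) 0 (zeroEnv Γ) (capped-zeroEnv Γ)))
      (≤-trans (≤-reflexive (+-identityʳ _)) (tower₂-mono k measure≤))

≥1⇒suc : ∀ {n} → 1 ≤ n → ∃[ m ] n ≡ suc m
≥1⇒suc (s≤s {n = m} _) = m , refl

proposition5p50 : ∀ {Γ A} (M : Γ ⊢ A) → StronglyLocallyScoped M → ord M ≥ 1 →
    ∃[ n ] (𝒩 M n × n ≤ℝ tower (ord M ∸ 1) (depth M ·ℝ log (lh M + ord M + 1)))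
proposition5p50 M s 1≤ord with ≥1⇒suc (1≤depthOf M []) | ≥1⇒suc 1≤ord | adequacy M
... | d , depth≡ | p , ord≡ | n , 𝒩n , n≤ = n , 𝒩n ,
  subst₂ (λ D P → n ≤ℝ tower (P ∸ 1) (D ·ℝ log (lh M + P + 1))) (sym depth≡) (sym ord≡)
    (≤ℝ-mono {x = tower p (suc d ·ℝ log (lh M + suc p + 1))} n≤ (total-≤ℝ M d p s depth≡ ord≡))
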